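{- Let $q=p^r$ be a power of a prime $p$ with $2\nmid q$, and let $0\le e\le r$. Every $e$-Klenian polynomial $f\in\mathbb{F}_q[x,y]$ has a companion which is a local permutation polynomial.
   Context: Let $q=p^r$ and let $\Sigma_q$ be the group of permutations of $\mathbb{F}_q$. Functions $\mathbb{F}_q^2\to\mathbb{F}_q$ are identified with polynomials in $\mathbb{F}_q[x,y]$ of degree less than $q$ in each variable. A polynomial $f\in\mathbb{F}_q[x,y]$ is a permutation polynomial if $f(x,y)=a$ has exactly $q$ solutions in $\mathbb{F}_q^2$ for each $a\in\mathbb{F}_q$. It is a local permutation polynomial (LPP) if for every $a\in\mathbb{F}_q$ both $f(a,y)$ and $f(x,a)$ induce permutations of $\mathbb{F}_q$. A polynomial $g\in\mathbb{F}_q[x,y]$ is a companion of a permutation polynomial $f$ if the map $(f,g):\mathbb{F}_q^2\to\mathbb{F}_q^2$ is a permutation. Tuple of an LPP: given an enumeration $\mathbb{F}_q=\{c_0,\dots,c_{q-1}\}$, an LPP $f$ determines the tuple $\underline{\beta}_f=(\beta_0,\dots,\beta_{q-1})\in\Sigma_q^q$, where $\beta_i$ is the permutation with $f(c_j,\beta_i(c_j))=c_i$ for all $j$. $e$-Klenian subgroup ($0\le e\le r$): let $l=p^e$ and $t=q/l$. An $e$-Klenian subgroup of $\Sigma_q$ is any group of the form $G=\{\alpha^i\beta^j: 0\le i\le l-1,\ 0\le j\le t-1\}$ where, for some enumeration $c_0,\dots,c_{q-1}$ of the elements of $\mathbb{F}_q$, $\alpha$ is the product of the $t$ disjoint cycles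 $(c_{il},c_{1+il},\dots,c_{(l-1)+il})$, $0\le i\le t-1$, and $\beta$ is the product of the $l$ disjoint cycles $(c_j,c_{j+l},\dots,c_{j+(t-1)l})$, $0\le j\le l-1$ (cycles of length $1$ are the identity). $e$-Klenian polynomial: an LPP $f$ such that the set $\{\beta_0,\dots,\beta_{q-1}\}$ of entries of $\underline{\beta}_f$ is an $e$-Klenian subgroup of $\Sigma_q$. -}

module Defs where

open import Algebra.Apartness.Structures using (IsHeytingField)
open import Data.Fin.Base using (Fin; toℕ; combine)
open import Data.Fin.Properties using (any?; inj⇒≟)
open import Data.List.Base using (List; foldr)
open import Data.Nat.Base as ℕ using (ℕ; suc)
open import Data.Nat.DivMod using (_mod_)
open import Data.Product.Base using (Σ; ∃-syntax; ∃₂; _×_; _,_; proj₁; proj₂)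
open import Data.Vec.Functional as Vector using (Vector)
open import Function.Base using (_∘_; id)
open import Function.Bundles using (_↔_; Inverse; mk↔ₛ′)
open import Function.Definitions using (Bijective)
open import Function.Properties.Inverse using (↔-sym; ↔⇒↣)
open import Level using (Level) renaming (suc to lsuc)
open import Relation.Binary.Definitions using (DecidableEquality)
open import Relation.Binary.PropositionalEquality
  using (_≡_; _≢_; _≗_; refl; sym; trans)
open import Relation.Nullary.Decidable using (yes; no)
open import Relation.Unary using (Pred; _≐_)

-- With ≢ as the apartness relation, a Heyting field is a field in the usual
-- sense: the elements distinct from 0# are exactly the invertible ones (hence
-- also 0# ≢ 1#).
record FiniteField (a : Level) (q : ℕ) : Set (lsuc a) where
  infixl 7 _*_
  infixl 6 _+_
  infix  8 -_
  field
    Carrier        : Set a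
    _+_ _*_        : Carrier → Carrier → Carrier
    -_             : Carrier → Carrier
    0# 1#          : Carrier
    isHeytingField : IsHeytingField _≡_ _≢_ _+_ _*_ -_ 0# 1#
    enumeration    : Fin q ↔ Carrier

  _≟_ : DecidableEquality Carrier
  _≟_ = inj⇒≟ (↔⇒↣ (↔-sym enumeration))

next : {m : ℕ} → Fin m → Fin m
next {suc m} k = suc (toℕ k) mod suc m

module _ {a : Level} {A : Set a} where

  -- cycle _≟_ x is the cycle (x₀, x₁, …, xₘ₋₁), for pairwise distinct xₖ.
  cycle : DecidableEquality A → {m : ℕ} → Vector A m → A → A
  cycle _≟_ x b with any? (λ k → x k ≟ b)
  ... | yes (k , _) = x (next k)
  ... | no  _       = b

  composite : {n : ℕ} → Vector (A → A) n → A → A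
  composite = Vector.foldr (λ σ τ → σ ∘ τ) id

module FieldDefs {a : Level} {q : ℕ} (𝔽 : FiniteField a q) where

  open FiniteField 𝔽

  IsPermutation : {B : Set a} → (B → B) → Set a
  IsPermutation = Bijective _≡_ _≡_

  Perm : Set a
  Perm = Carrier ↔ Carrier

  open Inverse using (to)

  -- Polynomials are lists of coefficients, the constant one first.
  -- 𝔽[x,y] is presented as 𝔽[y][x]: the i-th entry is the coefficient of xⁱ.
  Poly₁ : Set a
  Poly₁ = List Carrier

  Poly₂ : Set a
  Poly₂ = List Poly₁

  eval₁ : Poly₁ → Carrier → Carrier
  eval₁ f y = foldr (λ c v → c + y * v) 0# f

  eval₂ : Poly₂ → Carrier → Carrier → Carrier
  eval₂ f x y = foldr (λ h v → eval₁ h y + x * v) 0# f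

  IsPermutationPolynomial : Poly₂ → Set a
  IsPermutationPolynomial f =
    ∀ b → Fin q ↔ Σ (Carrier × Carrier) λ (x , y) → eval₂ f x y ≡ b

  IsLPP : Poly₂ → Set a
  IsLPP f = ∀ b → IsPermutation (λ y → eval₂ f b y)
                × IsPermutation (λ x → eval₂ f x b)

  IsCompanion : Poly₂ → Poly₂ → Set a
  IsCompanion g f =
    IsPermutationPolynomial f ×
    IsPermutation {Carrier × Carrier} (λ (x , y) → eval₂ f x y , eval₂ g x y)

  solve : {h : Carrier → Carrier} → IsPermutation h → Carrier → Carrier
  solve (_ , surj) b = proj₁ (surj b)

  solve-correct : {h : Carrier → Carrier} (π : IsPermutation h) →
                  ∀ b → h (solve π b) ≡ b
  solve-correct (_ , surj) b = proj₂ (surj b) refl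

  -- The permutation x ↦ y, where y is the solution of f(x,y) = b.
  levelPerm : (f : Poly₂) → IsLPP f → Carrier → Perm
  levelPerm f lpp b = mk↔ₛ′
    (λ x → solve (row x) b)
    (λ y → solve (col y) b)
    (λ y → proj₁ (row (solve (col y) b))
             (trans (solve-correct (row (solve (col y) b)) b)
                    (sym (solve-correct (col y) b))))
    (λ x → proj₁ (col (solve (row x) b))
             (trans (solve-correct (col (solve (row x) b)) b)
                    (sym (solve-correct (row x) b))))
    where
    row : ∀ x → IsPermutation (λ y → eval₂ f x y)
    row x = proj₁ (lpp x)
    col : ∀ y → IsPermutation (λ x → eval₂ f x y)
    col y = proj₂ (lpp y)

  tuple : (f : Poly₂) → IsLPP f → Vector Perm q
  tuple f lpp i = levelPerm f lpp (to enumeration i)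

  tuple-spec : (f : Poly₂) (lpp : IsLPP f) → let c = to enumeration in
               ∀ i j → eval₂ f (c j) (to (tuple f lpp i) (c j)) ≡ c i
  tuple-spec f lpp i j =
    solve-correct (proj₁ (lpp (to enumeration j))) (to enumeration i)

  Entries : {n : ℕ} → Vector Perm n → Pred Perm a
  Entries β π = ∃[ i ] to π ≗ to (β i)

module Klenian {a : Level} (p r : ℕ) (𝔽 : FiniteField a (p ℕ.^ r)) where

  open FiniteField 𝔽
  open FieldDefs 𝔽
  open Inverse using (to)

  -- The enumeration c₀, …, c_{q-1} is indexed by Fin (t * l), where t * l = q
  -- when e ≤ r; for i < t and k < l, combine i k is the index k + i l.
  IsKlenianSubgroup : ℕ → Pred Perm a → Set a
  IsKlenianSubgroup e G =
    Σ (Fin (t ℕ.* l) ↔ Carrier) λ c →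
    Σ Perm λ α →
    Σ Perm λ β →
      (to α ≗ composite {n = t} λ i → cycle _≟_ {l} λ k → to c (combine i k)) ×
      (to β ≗ composite {n = l} λ j → cycle _≟_ {t} λ k → to c (combine k j)) ×
      (G ≐ λ π → ∃₂ λ (i : Fin l) (j : Fin t) →
                   to π ≗ (to α ^ toℕ i) ∘ (to β ^ toℕ j))
    where
    open import Function.Endo.Propositional Carrier using (_^_)
    l t : ℕ
    l = p ℕ.^ e
    t = p ℕ.^ (r ℕ.∸ e)

  IsKlenianPolynomial : ℕ → Poly₂ → Set a
  IsKlenianPolynomial e f =
    Σ (IsLPP f) λ lpp → IsKlenianSubgroup e (Entries (tuple f lpp))

{-# OPTIONS --safe #-}

-- In the coordinates given by the enumeration c, an e-Klenian subgroup is the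
-- regular group of translations of ℤ/t × ℤ/l, so f(x,y) = b says that y − x is
-- a constant depending on b only.  A companion is g(x,y) = x + y: if x and x′
-- give the same y − x and the same x + y, then 2x = 2x′, and t and l are odd.
-- Every function 𝔽² → 𝔽 is polynomial by interpolation.
module Submission where

open import Defs
open import Algebra.Apartness.Structures using (IsHeytingField)
open import Algebra.Bundles using (CommutativeRing)
import Algebra.Solver.Ring.NaturalCoefficients.Default as SemiringSolver
open import Axiom.UniquenessOfIdentityProofs.WithK using (uip)
open import Data.Fin.Base using (Fin; zero; suc; toℕ; punchOut)
open import Data.Fin.Properties
  using (any?; *↔×; toℕ<n; toℕ-fromℕ<; toℕ-injective; injective⇒≤; punchOut-injective)
  renaming (_≟_ to _≟ᶠ_)
open import Data.List.Base using (List; []; _∷_; map; tabulate)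
open import Data.List.Membership.Propositional using (_∈_)
open import Data.List.Membership.Propositional.Properties using (∈-tabulate⁺)
open import Data.List.Relation.Unary.Any using (here; there)
open import Data.Nat.Base as ℕ using (ℕ; zero; suc; _^_; _≤_; NonZero)
open import Data.Nat.Divisibility using (_∣_; m%n≡0⇒n∣m; ∣m⇒∣m*n; ∣n⇒∣m*n)
open import Data.Nat.DivMod
  using (_%_; _/_; m≡m%n+[m/n]*n; m%n<n; m<n⇒m%n≡m; m%n%n≡m%n;
         %-distribˡ-+; %-distribˡ-*; [m+kn]%n≡m%n)
open import Data.Nat.Primality using (Prime)
import Data.Nat.Properties as ℕ
open import Data.Nat.Solver using (module +-*-Solver)
open import Data.Product.Base using (Σ; ∃₂; _×_; _,_; proj₁; proj₂; uncurry)
open import Data.Product.Function.NonDependent.Propositional using (_×-↔_)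
open import Data.Product.Properties using (,-injectiveˡ; ,-injectiveʳ)
open import Data.Unit.Base using (⊤; tt)
open import Data.Vec.Functional using (Vector)
open import Function.Base using (_∘_; flip)
open import Function.Bundles using (_↔_; Injection; Inverse; mk↔ₛ′)
open import Function.Construct.Composition using (_↔-∘_)
open import Function.Definitions using (Injective; StrictlySurjective; Bijective)
import Function.Endo.Propositional as Endo
open import Function.Properties.Inverse using (↔-sym; ↔⇒↣)
open import Level using (Level)
open import Relation.Binary.Definitions using (DecidableEquality)
open import Relation.Binary.PropositionalEquality
open import Relation.Nullary.Decidable using (yes; no)
open import Relation.Nullary.Negation using (¬_; contradiction)

open Inverse using (to; from; strictlyInverseˡ; strictlyInverseʳ)

private variable
  a b : Level
  A : Set a
  B : Set b
  m n : ℕ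

-- Injective self-maps of finite sets.

↔-injective : (A↔B : A ↔ B) → Injective _≡_ _≡_ (to A↔B)
↔-injective A↔B = Injection.injective (↔⇒↣ A↔B)

-- Pigeonhole: punching a missed value out of the codomain would give an injection from
-- `Fin (suc n)` to `Fin n`.
Fin-injective⇒surjective : {f : Fin n → Fin n} → Injective _≡_ _≡_ f →
                           StrictlySurjective _≡_ f
Fin-injective⇒surjective {n = suc n} {f} inj y with any? (λ x → f x ≟ᶠ y)
... | yes hit = hit
... | no miss = contradiction
  (injective⇒≤ {f = λ x → punchOut (y≢f x)}
    λ {x} {x′} eq → inj (punchOut-injective (y≢f x) (y≢f x′) eq))
  ℕ.1+n≰n
  where
  y≢f : ∀ x → y ≢ f x
  y≢f x eq = miss (x , sym eq)

injective⇒bijective : Fin n ↔ A → {f : A → A} → Injective _≡_ _≡_ f →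
                      Bijective _≡_ _≡_ f
injective⇒bijective enum {f} inj = inj , λ y →
  let x , eq = Fin-injective⇒surjective {f = from enum ∘ f ∘ to enum}
                 (↔-injective enum ∘ inj ∘ ↔-injective (↔-sym enum))
                 (from enum y)
  in to enum x , λ { refl → ↔-injective (↔-sym enum) eq }

-- Congruences modulo m.

module _ {m : ℕ} .{{_ : NonZero m}} where

  +-cong-% : ∀ {x x′ y y′} → x % m ≡ x′ % m → y % m ≡ y′ % m →
             (x ℕ.+ y) % m ≡ (x′ ℕ.+ y′) % m
  +-cong-% {x} {x′} {y} {y′} p q =
    trans (%-distribˡ-+ x y m)
      (trans (cong₂ (λ u v → (u ℕ.+ v) % m) p q) (sym (%-distribˡ-+ x′ y′ m)))

  *-congˡ-% : ∀ k {x y} → x % m ≡ y % m → (k ℕ.* x) % m ≡ (k ℕ.* y) % m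
  *-congˡ-% k {x} {y} p =
    trans (%-distribˡ-* k x m)
      (trans (cong (λ v → (k % m ℕ.* v) % m) p) (sym (%-distribˡ-* k y m)))

  -- Without subtraction, `k * pred m` serves as the negative of `k`: added to `k` it gives the
  -- multiple `k * m`.
  +-cancelˡ-% : ∀ k {x y} → (k ℕ.+ x) % m ≡ (k ℕ.+ y) % m → x % m ≡ y % m
  +-cancelˡ-% k {x} {y} p =
    trans (sym (add-multiple x)) (trans (+-cong-% {k ℕ.* ℕ.pred m} refl p) (add-multiple y))
    where
    add-multiple : ∀ z → (k ℕ.* ℕ.pred m ℕ.+ (k ℕ.+ z)) % m ≡ z % m
    add-multiple z = trans (cong (_% m) regroup) ([m+kn]%n≡m%n z k m)
      where
      open +-*-Solver
      regroup : k ℕ.* ℕ.pred m ℕ.+ (k ℕ.+ z) ≡ z ℕ.+ k ℕ.* m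
      regroup = trans
        (solve 3 (λ k n z → k :* n :+ (k :+ z) := z :+ k :* (con 1 :+ n)) refl k (ℕ.pred m) z)
        (cong (λ n → z ℕ.+ k ℕ.* n) (ℕ.suc-pred m))

  -- For m = 1 + 2h, the number 1 + h is an inverse of 2 modulo m.
  odd⇒double-cancel-% : ¬ 2 ∣ m → ∀ x y → (x ℕ.+ x) % m ≡ (y ℕ.+ y) % m → x % m ≡ y % m
  odd⇒double-cancel-% odd x y p =
    trans (sym (halve x)) (trans (*-congˡ-% (suc (m / 2)) p) (halve y))
    where
    m%2≡1 : m % 2 ≡ 1
    m%2≡1 with m % 2 in eq | m%n<n m 2
    ... | 0 | _ = contradiction (m%n≡0⇒n∣m m 2 eq) odd
    ... | 1 | _ = refl
    ... | suc (suc _) | ℕ.s≤s (ℕ.s≤s ())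
    halve : ∀ z → (suc (m / 2) ℕ.* (z ℕ.+ z)) % m ≡ z % m
    halve z = trans (cong (_% m) regroup) ([m+kn]%n≡m%n z z m)
      where
      open +-*-Solver
      regroup : suc (m / 2) ℕ.* (z ℕ.+ z) ≡ z ℕ.+ z ℕ.* m
      regroup = trans
        (solve 2 (λ h z → (con 1 :+ h) :* (z :+ z) := z :+ z :* (con 1 :+ h :* con 2)) refl (m / 2) z)
        (cong (λ n → z ℕ.+ z ℕ.* n)
          (sym (trans (m≡m%n+[m/n]*n m 2) (cong (ℕ._+ m / 2 ℕ.* 2) m%2≡1))))

-- The cyclic group ℤ/m on `Fin m`.

-- Translation by n in ℤ/m. Written as a power of `next`, it has the same shape as the powers of the
-- generators of a Klenian subgroup, so that `^-semiconj` can match the two.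
rotate : ℕ → Fin m → Fin m
rotate {m} n = next ^ᶠ n
  where open Endo (Fin m) renaming (_^_ to _^ᶠ_)

infixl 6 _⊕_
_⊕_ : Fin m → Fin m → Fin m
i ⊕ j = rotate (toℕ i) j

module _ {m : ℕ} where

  private
    M : ℕ
    M = suc m

  toℕ-rotate : ∀ n (k : Fin M) → toℕ (rotate n k) ≡ (n ℕ.+ toℕ k) % M
  toℕ-rotate zero k = sym (m<n⇒m%n≡m (toℕ<n k))
  toℕ-rotate (suc n) k =
    trans (toℕ-fromℕ< (m%n<n (suc (toℕ (rotate n k))) M))
      (+-cong-% {M} {1} {1} {toℕ (rotate n k)} {n ℕ.+ toℕ k} refl
        (trans (cong (_% M) (toℕ-rotate n k)) (m%n%n≡m%n (n ℕ.+ toℕ k) M)))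

  toℕ-injective-% : {i j : Fin M} → toℕ i % M ≡ toℕ j % M → i ≡ j
  toℕ-injective-% {i} {j} p = toℕ-injective
    (trans (sym (m<n⇒m%n≡m (toℕ<n i))) (trans p (m<n⇒m%n≡m (toℕ<n j))))

  rotate≡⇒% : ∀ n n′ {i j : Fin M} → rotate n i ≡ rotate n′ j →
              (n ℕ.+ toℕ i) % M ≡ (n′ ℕ.+ toℕ j) % M
  rotate≡⇒% n n′ {i} {j} eq =
    trans (sym (toℕ-rotate n i)) (trans (cong toℕ eq) (toℕ-rotate n′ j))

rotate-injective : ∀ n {i j : Fin m} → rotate n i ≡ rotate n j → i ≡ j
rotate-injective {suc m} n eq = toℕ-injective-% (+-cancelˡ-% n (rotate≡⇒% n n eq))

⊕-comm : (i j : Fin m) → i ⊕ j ≡ j ⊕ i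
⊕-comm {suc m} i j = toℕ-injective
  (trans (toℕ-rotate (toℕ i) j)
    (trans (cong (_% suc m) (ℕ.+-comm (toℕ i) (toℕ j))) (sym (toℕ-rotate (toℕ j) i))))

⊕-cancelˡ : (i : Fin m) {j k : Fin m} → i ⊕ j ≡ i ⊕ k → j ≡ k
⊕-cancelˡ i = rotate-injective (toℕ i)

⊕-cancelʳ : (i : Fin m) {j k : Fin m} → j ⊕ i ≡ k ⊕ i → j ≡ k
⊕-cancelʳ i {j} {k} eq = ⊕-cancelˡ i (trans (⊕-comm i j) (trans eq (⊕-comm k i)))

odd⇒double-injective : ¬ 2 ∣ m → {i j : Fin m} → i ⊕ i ≡ j ⊕ j → i ≡ j
odd⇒double-injective {suc m} odd {i} {j} eq =
  toℕ-injective-% (odd⇒double-cancel-% odd (toℕ i) (toℕ j) (rotate≡⇒% (toℕ i) (toℕ j) eq))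

-- Both sides apply a power of `next` to `j`, and the exponents, `toℕ i + n` and `n + toℕ i`, agree.
⊕-rotateʳ : ∀ n (i j : Fin m) → i ⊕ rotate n j ≡ rotate n (i ⊕ j)
⊕-rotateʳ {m} n i j = trans
  (sym (cong (λ h → h j) (^-homo next (toℕ i) n)))
  (trans (cong (flip rotate j) (ℕ.+-comm (toℕ i) n)) (cong (λ h → h j) (^-homo next n (toℕ i))))
  where open Endo (Fin m)

-- This recovers a point from its difference `n` to a second point and the sum of the two. The
-- rotation moves out of the sum and cancels, which leaves the doubles of `i` and `j`.
odd⇒difference-sum-injective : ¬ 2 ∣ m → ∀ n {i j : Fin m} →
                               i ⊕ rotate n i ≡ j ⊕ rotate n j → i ≡ j
odd⇒difference-sum-injective odd n {i} {j} eq = odd⇒double-injective odd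
  (rotate-injective n (trans (sym (⊕-rotateʳ n i i)) (trans eq (⊕-rotateʳ n j j))))

-- Powers of maps and products of disjoint cycles.

module _ {A : Set a} {B : Set b} {g : A → A} {s : B → B} {h : B → A} where

  open Endo A using () renaming (_^_ to _^ᴬ_)
  open Endo B using () renaming (_^_ to _^ᴮ_)

  -- With `h` a row or column of the coordinate grid and `s` equal to `next`, this turns powers of
  -- the Klenian generators into rotations.
  ^-semiconj : (∀ x → g (h x) ≡ h (s x)) → ∀ n x → (g ^ᴬ n) (h x) ≡ h ((s ^ᴮ n) x)
  ^-semiconj semiconj zero    x = refl
  ^-semiconj semiconj (suc n) x =
    trans (cong g (^-semiconj semiconj n x)) (semiconj ((s ^ᴮ n) x))

module _ {A : Set a} (_≟_ : DecidableEquality A) where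

  cycle-∈ : (x : Vector A m) → Injective _≡_ _≡_ x → ∀ k → cycle _≟_ x (x k) ≡ x (next k)
  cycle-∈ x inj k with any? (λ j → x j ≟ x k)
  ... | yes (_ , eq) = cong (x ∘ next) (inj eq)
  ... | no miss      = contradiction (k , refl) miss

  cycle-∉ : (x : Vector A m) {b : A} → (∀ k → x k ≢ b) → cycle _≟_ x b ≡ b
  cycle-∉ x {b} miss with any? (λ j → x j ≟ b)
  ... | yes (k , eq) = contradiction eq (miss k)
  ... | no _         = refl

composite-fixed : (σ : Vector (A → A) n) {x : A} → (∀ i → σ i x ≡ x) → composite σ x ≡ x
composite-fixed {n = zero}  σ fixed = refl
composite-fixed {n = suc n} σ fixed =
  trans (cong (σ zero) (composite-fixed (σ ∘ suc) (fixed ∘ suc))) (fixed zero)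

-- Factors act from the last index to the first: those after `i` meet `x`, those before `i` meet
-- `y`. Hence they are asked to fix both points.
composite-moved : (σ : Vector (A → A) n) (i : Fin n) {x y : A} → σ i x ≡ y →
                  (∀ j → j ≢ i → σ j x ≡ x) → (∀ j → j ≢ i → σ j y ≡ y) →
                  composite σ x ≡ y
composite-moved σ zero move fixˣ fixʸ =
  trans (cong (σ zero) (composite-fixed (σ ∘ suc) (λ j → fixˣ (suc j) λ ()))) move
composite-moved σ (suc i) move fixˣ fixʸ = trans
  (cong (σ zero) (composite-moved (σ ∘ suc) i move
    (λ j j≢i → fixˣ (suc j) λ { refl → j≢i refl })
    (λ j j≢i → fixʸ (suc j) λ { refl → j≢i refl })))
  (fixʸ zero λ ())

-- Injectivity of `uncurry x` says at once that no cycle repeats an element and that distinct cycles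
-- are disjoint, so only the `i`-th factor moves a point of the `i`-th cycle.
composite-cycles : (_≟_ : DecidableEquality A) (x : Fin n → Vector A m) →
                   Injective _≡_ _≡_ (uncurry x) → ∀ i k →
                   composite (λ j → cycle _≟_ (x j)) (x i k) ≡ x i (next k)
composite-cycles _≟_ x inj i k = composite-moved _ i
  (cycle-∈ _≟_ (x i) (,-injectiveʳ ∘ inj) k)
  (λ j → other k j)
  (λ j → other (next k) j)
  where
  other : ∀ k j → j ≢ i → cycle _≟_ (x j) (x i k) ≡ x i k
  other k j j≢i = cycle-∉ _≟_ (x j) (λ k′ → j≢i ∘ ,-injectiveˡ ∘ inj)

-- Newton interpolation in one and two variables.

module Interpolation {q : ℕ} (𝔽 : FiniteField a q) where

  open FiniteField 𝔽
  open FieldDefs 𝔽 using (Poly₁; Poly₂; eval₁; eval₂)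
  open IsHeytingField isHeytingField using (isCommutativeRing; #⇒invertible)

  private
    ring : CommutativeRing a a
    ring = record { isCommutativeRing = isCommutativeRing }

  open CommutativeRing ring
    using (_-_; zeroˡ; zeroʳ; +-comm; +-identityʳ; *-assoc; *-identityˡ; -‿inverseʳ;
           +-group; commutativeSemiring)
  open import Algebra.Properties.Group +-group using (//-rightDividesˡ)
  open SemiringSolver commutativeSemiring using (solve; _:+_; _:*_; _:=_)

  divided-difference : Carrier → (Carrier → Carrier) → Carrier → Carrier
  divided-difference x h y with y ≟ x
  -- The default is harmless: the quotient is always multiplied by y - x, which is zero here.
  ... | yes _  = 0#
  ... | no y≢x = proj₁ (#⇒invertible y≢x) * (h y - h x)

  divided-difference-spec : ∀ x h y → h x + (y - x) * divided-difference x h y ≡ h y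
  divided-difference-spec x h y with y ≟ x
  ... | yes refl = trans (cong (h x +_) (zeroʳ (x - x))) (+-identityʳ (h x))
  ... | no y≢x with #⇒invertible y≢x
  ...   | i , _ , inv = begin
    h x + (y - x) * (i * (h y - h x)) ≡⟨ cong (h x +_) (*-assoc (y - x) i (h y - h x)) ⟨
    h x + (y - x) * i * (h y - h x)   ≡⟨ cong (λ v → h x + v * (h y - h x)) inv ⟩
    h x + 1# * (h y - h x)            ≡⟨ cong (h x +_) (*-identityˡ (h y - h x)) ⟩
    h x + (h y - h x)                 ≡⟨ +-comm (h x) (h y - h x) ⟩
    h y - h x + h x                   ≡⟨ //-rightDividesˡ (h x) (h y) ⟩
    h y                               ∎
    where open ≡-Reasoning

  -- Coefficients depend on a parameter, so that the coefficients of a bivariate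
  -- interpolant are functions of y, to be interpolated in turn.
  module _ {B : Set b} where

    _at_ : List (B → Carrier) → B → Poly₁
    f at z = map (λ c → c z) f

    -- The polynomial c + (X − x) f.
    linear-factor : (B → Carrier) → Carrier → List (B → Carrier) → List (B → Carrier)
    linear-factor c x []      = c ∷ []
    linear-factor c x (d ∷ f) = (λ z → c z + - x * d z) ∷ linear-factor d x f

    eval-linear-factor : ∀ c x f y z →
      eval₁ (linear-factor c x f at z) y ≡ c z + (y - x) * eval₁ (f at z) y
    eval-linear-factor c x []      y z =
      cong (c z +_) (trans (zeroʳ y) (sym (zeroʳ (y - x))))
    eval-linear-factor c x (d ∷ f) y z = trans
      (cong (λ v → c z + - x * d z + y * v) (eval-linear-factor d x f y z))
      (solve 5 (λ c d -x y v → (c :+ -x :* d) :+ y :* (d :+ (y :+ -x) :* v)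
                             := c :+ (y :+ -x) :* (d :+ y :* v)) refl
        (c z) (d z) (- x) y (eval₁ (f at z) y))

    -- Newton's form of the interpolant: the value at the first node, plus X - x times the
    -- interpolant of the divided difference at the remaining nodes.
    newton : List Carrier → (Carrier → B → Carrier) → List (B → Carrier)
    newton []       h = []
    newton (x ∷ xs) h = linear-factor (h x) x
      (newton xs λ y z → divided-difference x (λ y′ → h y′ z) y)

    -- At the head node the factor y - x vanishes and leaves `h x`. At a later node the inner
    -- interpolant equals the divided difference, from which `h y` is rebuilt.
    eval-newton : ∀ {xs} h {y} → y ∈ xs → ∀ z → eval₁ (newton xs h at z) y ≡ h y z
    eval-newton {x ∷ xs} h {y} y∈ z = trans (eval-linear-factor (h x) x f y z) (value y∈)
      where
      h′ : Carrier → B → Carrier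
      h′ y z = divided-difference x (λ y′ → h y′ z) y
      f : List (B → Carrier)
      f = newton xs h′
      value : y ∈ x ∷ xs → h x z + (y - x) * eval₁ (f at z) y ≡ h y z
      value (here refl) = trans
        (cong (λ v → h x z + v * eval₁ (f at z) x) (-‿inverseʳ x))
        (trans (cong (h x z +_) (zeroˡ (eval₁ (f at z) x))) (+-identityʳ (h x z)))
      value (there y∈xs) = trans
        (cong (λ v → h x z + (y - x) * v) (eval-newton h′ y∈xs z))
        (divided-difference-spec x (λ y′ → h y′ z) y)

    interpolate : (Carrier → B → Carrier) → List (B → Carrier)
    interpolate = newton (tabulate (to enumeration))

    eval-interpolate : ∀ h y z → eval₁ (interpolate h at z) y ≡ h y z
    eval-interpolate h y = eval-newton h
      (subst (_∈ tabulate (to enumeration)) (strictlyInverseˡ enumeration y)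
        (∈-tabulate⁺ (from enumeration y)))

  interpolate₁ : (Carrier → Carrier) → Poly₁
  interpolate₁ h = interpolate {B = ⊤} (λ y _ → h y) at tt

  eval-interpolate₁ : ∀ h y → eval₁ (interpolate₁ h) y ≡ h y
  eval-interpolate₁ h y = eval-interpolate (λ y _ → h y) y tt

  interpolate₂ : (Carrier → Carrier → Carrier) → Poly₂
  interpolate₂ h = map interpolate₁ (interpolate h)

  eval-interpolate₂ : ∀ h x y → eval₂ (interpolate₂ h) x y ≡ h x y
  eval-interpolate₂ h x y = trans (eval₂-map (interpolate h)) (eval-interpolate h x y)
    where
    eval₂-map : ∀ f → eval₂ (map interpolate₁ f) x y ≡ eval₁ (f at y) x
    eval₂-map []      = refl
    eval₂-map (c ∷ f) = cong₂ (λ u v → u + x * v) (eval-interpolate₁ c y) (eval₂-map f)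

-- Local permutation polynomials and companions.

module LPP {q : ℕ} (𝔽 : FiniteField a q) where

  open FiniteField 𝔽
  open FieldDefs 𝔽

  levelPerm-spec : ∀ f lpp {b} x {y} → eval₂ f x y ≡ b → to (levelPerm f lpp b) x ≡ y
  levelPerm-spec f lpp x {y} eq =
    proj₁ (proj₁ (lpp x)) (trans (solve-correct (proj₁ (lpp x)) _) (sym eq))

  -- The solutions of f(x,y) = b form the graph of the level permutation of b, so projection to x
  -- puts them in bijection with the field.
  LPP⇒permutationPolynomial : ∀ f → IsLPP f → IsPermutationPolynomial f
  LPP⇒permutationPolynomial f lpp b = mk↔ₛ′ (point ∘ to enumeration) (from enumeration ∘ abscissa)
    (λ s → trans (cong point (strictlyInverseˡ enumeration (abscissa s))) (point-abscissa s))
    (strictlyInverseʳ enumeration)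
    where
    Solution : Set _
    Solution = Σ (Carrier × Carrier) λ (x , y) → eval₂ f x y ≡ b
    point : Carrier → Solution
    point x = (x , to (levelPerm f lpp b) x) , solve-correct (proj₁ (lpp x)) b
    abscissa : Solution → Carrier
    abscissa ((x , _) , _) = x
    point-abscissa : ∀ s → point (abscissa s) ≡ s
    point-abscissa ((x , y) , eq) with levelPerm-spec f lpp x eq
    -- Once the points agree, only the two proofs of the equation remain to be identified.
    ... | refl = cong ((x , y) ,_) (uip _ eq)

  injective⇒LPP : ∀ f → (∀ x {y y′} → eval₂ f x y ≡ eval₂ f x y′ → y ≡ y′) →
                  (∀ y {x x′} → eval₂ f x y ≡ eval₂ f x′ y → x ≡ x′) → IsLPP f
  injective⇒LPP f injʳ injˡ b =
    injective⇒bijective enumeration (injʳ b) , injective⇒bijective enumeration (injˡ b)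

  -- It is enough to recover x from the pair of values: y then follows because f(x,·) is injective.
  -- Finiteness of the plane supplies surjectivity.
  injective⇒companion : ∀ f g → IsLPP f →
    (∀ {x x′ y y′} → eval₂ f x y ≡ eval₂ f x′ y′ → eval₂ g x y ≡ eval₂ g x′ y′ → x ≡ x′) →
    IsCompanion g f
  injective⇒companion f g lpp inj = LPP⇒permutationPolynomial f lpp ,
    injective⇒bijective ((enumeration ×-↔ enumeration) ↔-∘ *↔×) pair-injective
    where
    pair-injective : Injective _≡_ _≡_ (λ (x , y) → eval₂ f x y , eval₂ g x y)
    pair-injective {x , y} {x′ , y′} eq with inj {x} {x′} {y} {y′} (,-injectiveˡ eq) (,-injectiveʳ eq)
    ... | refl = cong (x ,_) (proj₁ (proj₁ (lpp x)) (,-injectiveˡ eq))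

-- The companion of a Klenian polynomial.

theorem37 : {a : Level} (p r : ℕ) → Prime p → ¬ (2 ∣ p ^ r) →
    (e : ℕ) → e ≤ r →
    (𝔽 : FiniteField a (p ^ r)) →
    let open FieldDefs 𝔽 in
    (f : Poly₂) → Klenian.IsKlenianPolynomial p r 𝔽 e f →
    Σ Poly₂ (λ g → IsCompanion g f × IsLPP g)
theorem37 p r _ odd e e≤r 𝔽 f (lpp , c , α , β , α≗ , β≗ , G⊆ , _) =
  g , injective⇒companion f g lpp separates ,
  injective⇒LPP g (λ x {y} {y′} eq → g-injectiveʳ x (trans (sym (g≗ x y)) (trans eq (g≗ x y′))))
                  (λ y {x} {x′} eq → g-injectiveˡ y (trans (sym (g≗ x y)) (trans eq (g≗ x′ y))))
  where
  open FiniteField 𝔽 using (Carrier; _≟_; enumeration)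
  open FieldDefs 𝔽
  open LPP 𝔽
  open Interpolation 𝔽
  open Endo Carrier renaming (_^_ to _^ᴱ_) using ()

  l t : ℕ
  l = p ^ e
  t = p ^ (r ℕ.∸ e)

  t*l≡q : t ℕ.* l ≡ p ^ r
  t*l≡q = trans (sym (ℕ.^-distribˡ-+-* p (r ℕ.∸ e) e)) (cong (p ^_) (ℕ.m∸n+n≡m e≤r))

  l-odd : ¬ 2 ∣ l
  l-odd 2∣l = odd (subst (2 ∣_) t*l≡q (∣n⇒∣m*n t 2∣l))

  t-odd : ¬ 2 ∣ t
  t-odd 2∣t = odd (subst (2 ∣_) t*l≡q (∣m⇒∣m*n l 2∣t))

  -- Grid coordinates on the field. Since `*↔×` is inverse to `combine`, the cycles of `α` are
  -- exactly the rows of this grid and those of `β` its columns.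
  κ : (Fin t × Fin l) ↔ Carrier
  κ = c ↔-∘ ↔-sym *↔×

  row : Carrier → Fin t
  row x = proj₁ (from κ x)

  col : Carrier → Fin l
  col x = proj₂ (from κ x)

  κ-row-col : ∀ x → to κ (row x , col x) ≡ x
  κ-row-col = strictlyInverseˡ κ

  row-col-injective : ∀ {x y} → row x ≡ row y → col x ≡ col y → x ≡ y
  row-col-injective p q = ↔-injective (↔-sym κ) (cong₂ _,_ p q)

  α-shifts : ∀ i k → to α (to κ (i , k)) ≡ to κ (i , next k)
  α-shifts i k = trans (α≗ _) (composite-cycles _≟_ (λ i k → to κ (i , k)) (↔-injective κ) i k)

  β-shifts : ∀ i k → to β (to κ (i , k)) ≡ to κ (next i , k)
  β-shifts i k = trans (β≗ _)
    (composite-cycles _≟_ (λ k i → to κ (i , k))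
      -- The cycles of `β` are indexed by the column first, so the two coordinates are swapped.
      (λ eq → let eq′ = ↔-injective κ eq in cong₂ _,_ (,-injectiveʳ eq′) (,-injectiveˡ eq′)) k i)

  -- The level permutation of `b` is an entry of the tuple, hence some α^k β^j, which acts on the
  -- grid as translation by (j, k). The shifts are chosen before x and y, so they are common to all
  -- solutions at level `b`.
  level-translates : ∀ b → ∃₂ λ n n′ → ∀ {x y} → eval₂ f x y ≡ b →
                     row y ≡ rotate n (row x) × col y ≡ rotate n′ (col x)
  level-translates b with G⊆ {levelPerm f lpp b}
    -- The tuple is indexed by `Fin`, so its entry at the index of `b` is the level permutation of
    -- `b` only after a round trip through the enumeration.
    (from enumeration b , λ x → cong (λ b → to (levelPerm f lpp b) x) (sym (strictlyInverseˡ enumeration b)))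
  ... | k , j , eq = toℕ j , toℕ k , λ {x} {y} fxy≡b →
    let y≡ : y ≡ to κ (rotate (toℕ j) (row x) , rotate (toℕ k) (col x))
        y≡ = begin
          y
            ≡⟨ levelPerm-spec f lpp x fxy≡b ⟨
          to (levelPerm f lpp b) x
            ≡⟨ eq x ⟩
          (to α ^ᴱ toℕ k) ((to β ^ᴱ toℕ j) x)
            ≡⟨ cong ((to α ^ᴱ toℕ k) ∘ (to β ^ᴱ toℕ j)) (κ-row-col x) ⟨
          (to α ^ᴱ toℕ k) ((to β ^ᴱ toℕ j) (to κ (row x , col x)))
            ≡⟨ cong (to α ^ᴱ toℕ k) (^-semiconj (λ i → β-shifts i (col x)) (toℕ j) (row x)) ⟩
          (to α ^ᴱ toℕ k) (to κ (rotate (toℕ j) (row x) , col x))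
            ≡⟨ ^-semiconj (α-shifts _) (toℕ k) (col x) ⟩
          to κ (rotate (toℕ j) (row x) , rotate (toℕ k) (col x)) ∎
        coords = trans (cong (from κ) y≡) (strictlyInverseʳ κ _)
    in ,-injectiveˡ coords , ,-injectiveʳ coords
    where open ≡-Reasoning

  -- Addition of ℤ/t × ℤ/l carried over to the field by `κ`; it is not defined from the field
  -- addition.
  _⊞_ : Carrier → Carrier → Carrier
  x ⊞ y = to κ (row x ⊕ row y , col x ⊕ col y)

  g : Poly₂
  g = interpolate₂ _⊞_

  g≗ : ∀ x y → eval₂ g x y ≡ x ⊞ y
  g≗ = eval-interpolate₂ _⊞_

  g-injectiveʳ : ∀ x {y y′} → x ⊞ y ≡ x ⊞ y′ → y ≡ y′
  g-injectiveʳ x eq = let eq′ = ↔-injective κ eq in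
    row-col-injective (⊕-cancelˡ (row x) (,-injectiveˡ eq′)) (⊕-cancelˡ (col x) (,-injectiveʳ eq′))

  g-injectiveˡ : ∀ y {x x′} → x ⊞ y ≡ x′ ⊞ y → x ≡ x′
  g-injectiveˡ y eq = let eq′ = ↔-injective κ eq in
    row-col-injective (⊕-cancelʳ (row y) (,-injectiveˡ eq′)) (⊕-cancelʳ (col y) (,-injectiveʳ eq′))

  -- Both pairs lie at the same level of f, so one translation takes x to y and x′ to y′.
  -- Substituting it into the equal sums lets oddness of t and l determine the row and the column of
  -- x.
  separates : ∀ {x x′ y y′} → eval₂ f x y ≡ eval₂ f x′ y′ → eval₂ g x y ≡ eval₂ g x′ y′ → x ≡ x′
  separates {x} {x′} {y} {y′} f≡ g≡ with level-translates (eval₂ f x′ y′)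
  ... | n , n′ , translates =
    let row-y  , col-y  = translates f≡
        row-y′ , col-y′ = translates {x′} {y′} refl
        sum = ↔-injective κ (trans (sym (g≗ x y)) (trans g≡ (g≗ x′ y′)))
    in row-col-injective
      (odd⇒difference-sum-injective t-odd n
        (trans (cong (row x ⊕_) (sym row-y)) (trans (,-injectiveˡ sum) (cong (row x′ ⊕_) row-y′))))
      (odd⇒difference-sum-injective l-odd n′
        (trans (cong (col x ⊕_) (sym col-y)) (trans (,-injectiveʳ sum) (cong (col x′ ⊕_) col-y′))))
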